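{- Let $k\ge2$. Let $P_1,\ldots,P_k$ be uniformly L-bounded posets with $\hat 0$, such that $e_1\ge\cdots\ge e_k$, where $e_i=e(P_i)$. Then the wedge $P=\mathcal V(P_1,\ldots,P_k)$ is lower-L-bounded. In addition, if $e_1>e_2$, then $P$ is L-bounded.
   Context: All posets are finite and nonempty. Let $[n]=\{1,\dots,n\}$; families of subsets of $[n]$ are ordered by inclusion. A poset $(P,\le)$ contains a poset $(P',\le')$ as a (weak) subposet if there is an injection $f:P'\to P$ such that $u\le' v$ implies $f(u)\le f(v)$. A family $\mathcal F\subseteq 2^{[n]}$ is $P$-free if it does not contain $P$ in this sense. $e(P)$ is the maximum integer $k\ge 0$ such that for all integers $n$ and $s$ the family $\binom{[n]}{s}\cup\binom{[n]}{s+1}\cup\cdots\cup\binom{[n]}{s+k-1}$ is $P$-free, where $\binom{[n]}{j}$ is the collection of $j$-element subsets of $[n]$ (empty if $j<0$ or $j>n$). The Lubell function of $\mathcal F\subseteq 2^{[n]}$ is the average over all $n!$ full (maximal) chains $\mathcal C$ of $2^{[n]}$ of $|\mathcal F\cap\mathcal C|$; equivalently $\bar h_n(\mathcal F)=\sum_{F\in\mathcal F}1/\binom{n}{|F|}$. For an integer $m\ge0$, $P$ is $m$-L-bounded if for all $n$, $\bar h_n(\mathcal F)\le e(P)$ for every $P$-free family $\mathcal F$ of subsets of $[n]$ all of whose members have sizes in $[m,n-m]$. $P$ is uniformly L-bounded if it is $0$-L-bounded, and L-bounded if it is $m$-L-bounded for some integer $m\ge 0$. $P$ is lower-L-bounded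 if for any $\beta\in(\frac12,1)$ and $\varepsilon>0$ there exists $N=N(\beta,\varepsilon)$ such that for all $n\ge N$, $\bar h_n(\mathcal F)\le e(P)+\varepsilon$ for all $P$-free families $\mathcal F$ of subsets of $[n]$ of sizes less than $\beta n$. An element $x$ of a poset $P$ is $\hat 0$ if $x\le p$ for all $p\in P$. For posets $P_1,\dots,P_k$ with $\hat 0$, the wedge $\mathcal V(P_1,\ldots,P_k)$ is the poset obtained from their disjoint union by identifying the $\hat 0$'s of the posets (elements of different $P_i$ other than the common $\hat 0$ are incomparable). -}

module Defs where

open import Data.Fin.Base using (Fin; zero)
open import Data.Fin.Properties using () renaming (_≟_ to _≟ᶠ_)
open import Data.Fin.Subset using (Subset; inside; outside; ∣_∣; _⊆_)
open import Data.Fin.Subset.Properties using (∣p∣≤n)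
open import Data.Integer.Base as ℤ using (ℤ; +_; 1ℤ)
open import Data.List.Base using (List; []; _∷_; _++_; map; concat; tabulate; filter; foldr)
import Data.List.Relation.Unary.Any as Any
import Data.List.Relation.Unary.Any.Properties as Any
open import Data.List.Relation.Unary.Enumerates.Setoid using (IsEnumeration)
open import Data.Nat.Base using (ℕ; zero; suc; _+_; _≤_; z≤n; s≤s; NonZero; >-nonZero; >-nonZero⁻¹)
open import Data.Nat.Combinatorics using (_C_; nCk≡nC[n∸k]; nCn≡1; nCk+nC[k+1]≡[n+1]C[k+1])
open import Data.Nat.Properties using (≤-trans; ≤-reflexive; m≤m+n)
open import Data.Product.Base using (Σ; ∃; _×_; _,_; proj₁; proj₂)
open import Data.Rational.Base as ℚ using (ℚ; 0ℚ; 1ℚ; ½)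
open import Data.Vec.Base using ([]; _∷_)
open import Function.Definitions using (Injective)
open import Level using (0ℓ)
open import Relation.Binary.Bundles using (DecPoset)
open import Relation.Binary.Definitions using (Decidable; Minimum; Reflexive; Symmetric; Transitive; Antisymmetric)
open import Relation.Binary.Morphism.Structures using (IsOrderHomomorphism)
open import Relation.Binary.PropositionalEquality.Core using (_≡_; refl; sym; trans)
open import Relation.Nullary using (¬_; yes; no)
open import Relation.Unary using (Pred) renaming (Decidable to Decidable₁)

-- Equality of elements is the poset's own equality _≈_, so that elements can
-- be identified with one another without forming a quotient type.
record FinPoset : Set₁ where
  field
    decPoset : DecPoset 0ℓ 0ℓ 0ℓ
  open DecPoset decPoset public
    using (Carrier; _≈_; _≤?_; _≟_; isPartialOrder; antisym)
    renaming (_≤_ to _⊑_; refl to ⊑-refl; reflexive to ⊑-reflexive; trans to ⊑-trans)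
  module Eq = DecPoset.Eq decPoset
  field
    elements : List Carrier
    complete : IsEnumeration Eq.setoid elements
    point    : Carrier

HasBottom : FinPoset → Set
HasBottom P = ∃ (Minimum (FinPoset._⊑_ P))

-- The carrier is the disjoint union; all the bottoms are equal for _≈ᵂ_.
module Wedge {k : ℕ} (P : Fin (suc k) → FinPoset) (bot : ∀ i → HasBottom (P i)) where

  private
    module P i = FinPoset (P i)

  0̂ : ∀ i → P.Carrier i
  0̂ i = proj₁ (bot i)

  Carrierᵂ : Set
  Carrierᵂ = Σ (Fin (suc k)) P.Carrier

  data _≈ᵂ_ : Carrierᵂ → Carrierᵂ → Set where
    glue   : ∀ {i j x y} → P._≈_ i x (0̂ i) → P._≈_ j y (0̂ j) → (i , x) ≈ᵂ (j , y)
    within : ∀ {i x y} → P._≈_ i x y → (i , x) ≈ᵂ (i , y)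

  data _≤ᵂ_ : Carrierᵂ → Carrierᵂ → Set where
    bottom : ∀ {i j x y} → P._≈_ i x (0̂ i) → (i , x) ≤ᵂ (j , y)
    within : ∀ {i x y} → P._⊑_ i x y → (i , x) ≤ᵂ (i , y)

  private
    below-0̂ : ∀ i {x y} → P._⊑_ i x y → P._≈_ i y (0̂ i) → P._≈_ i x (0̂ i)
    below-0̂ i x≤y y≈0 =
      P.antisym i (P.⊑-trans i x≤y (P.⊑-reflexive i y≈0)) (proj₂ (bot i) _)

    ≈-refl : Reflexive _≈ᵂ_
    ≈-refl {i , _} = within (P.Eq.refl i)

    ≈-sym : Symmetric _≈ᵂ_
    ≈-sym (glue p q) = glue q p
    ≈-sym {i , _} (within p) = within (P.Eq.sym i p)

    ≈-trans : Transitive _≈ᵂ_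
    ≈-trans (glue p _) (glue _ q) = glue p q
    ≈-trans {_} {i , _} (glue p q) (within r) = glue p (P.Eq.trans i (P.Eq.sym i r) q)
    ≈-trans {i , _} (within p) (glue q r) = glue (P.Eq.trans i p q) r
    ≈-trans {i , _} (within p) (within q) = within (P.Eq.trans i p q)

    ≤-reflexiveᵂ : ∀ {u v} → u ≈ᵂ v → u ≤ᵂ v
    ≤-reflexiveᵂ (glue p _) = bottom p
    ≤-reflexiveᵂ {i , _} (within p) = within (P.⊑-reflexive i p)

    ≤-transᵂ : Transitive _≤ᵂ_
    ≤-transᵂ (bottom p) _          = bottom p
    ≤-transᵂ {i , _} (within p) (bottom q) = bottom (below-0̂ i p q)
    ≤-transᵂ {i , _} (within p) (within q) = within (P.⊑-trans i p q)

    ≤-antisymᵂ : Antisymmetric _≈ᵂ_ _≤ᵂ_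
    ≤-antisymᵂ (bottom p) (bottom q) = glue p q
    ≤-antisymᵂ {i , _} (bottom p) (within q) = glue p (below-0̂ i q p)
    ≤-antisymᵂ {i , _} (within p) (bottom q) = glue (below-0̂ i p q) q
    ≤-antisymᵂ {i , _} (within p) (within q) = within (P.antisym i p q)

    _≤ᵂ?_ : Decidable _≤ᵂ_
    (i , x) ≤ᵂ? (j , y) with P._≟_ i x (0̂ i)
    ... | yes p = yes (bottom p)
    ... | no ¬p with i ≟ᶠ j
    ...   | no i≢j = no λ { (bottom p) → ¬p p ; (within _) → i≢j refl }
    ...   | yes refl with P._≤?_ i x y
    ...     | yes q = yes (within q)
    ...     | no ¬q = no λ { (bottom p) → ¬p p ; (within q) → ¬q q }

    _≈ᵂ?_ : Decidable _≈ᵂ_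
    u ≈ᵂ? v with u ≤ᵂ? v | v ≤ᵂ? u
    ... | yes p | yes q = yes (≤-antisymᵂ p q)
    ... | no ¬p | _     = no λ e → ¬p (≤-reflexiveᵂ e)
    ... | yes _ | no ¬q = no λ e → ¬q (≤-reflexiveᵂ (≈-sym e))

    elementsAt : Fin (suc k) → List Carrierᵂ
    elementsAt i = map (i ,_) (P.elements i)

  wedge : FinPoset
  wedge = record
    { decPoset = record
      { Carrier = Carrierᵂ
      ; _≈_ = _≈ᵂ_
      ; _≤_ = _≤ᵂ_
      ; isDecPartialOrder = record
        { isPartialOrder = record
          { isPreorder = record
            { isEquivalence = record { refl = ≈-refl ; sym = ≈-sym ; trans = ≈-trans }
            ; reflexive = ≤-reflexiveᵂ
            ; trans = ≤-transᵂ
            }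
          ; antisym = ≤-antisymᵂ
          }
        ; _≟_ = _≈ᵂ?_
        ; _≤?_ = _≤ᵂ?_
        }
      }
    ; elements = concat (tabulate elementsAt)
    ; complete = λ { (i , x) →
        Any.concat⁺ (Any.tabulate⁺ {f = elementsAt} i (Any.map⁺ (Any.map within (P.complete i x)))) }
    ; point = zero , 0̂ zero
    }

open Wedge public using (wedge)

Family : ℕ → Set₁
Family n = Pred (Subset n) 0ℓ

record _ContainedIn_ (P : FinPoset) {n : ℕ} (F : Family n) : Set where
  open FinPoset P using (Carrier; _≈_; _⊑_)
  field
    f           : Carrier → Subset n
    f-member    : ∀ u → F (f u)
    f-monotone  : IsOrderHomomorphism _≈_ _≡_ _⊑_ _⊆_ f
    f-injective : Injective _≈_ _≡_ f

Free : FinPoset → {n : ℕ} → Family n → Set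
Free P F = ¬ (P ContainedIn F)

levels : (n : ℕ) (s : ℤ) (k : ℕ) → Family n
levels n s k A = s ℤ.≤ + ∣ A ∣ × + ∣ A ∣ ℤ.< s ℤ.+ + k

LevelsFree : FinPoset → ℕ → Set
LevelsFree P k = ∀ (n : ℕ) (s : ℤ) → Free P (levels n s k)

-- e(P) = k, as a relation, since the maximum is over an infinite search.
IsE : FinPoset → ℕ → Set
IsE P k = LevelsFree P k × (∀ k′ → LevelsFree P k′ → k′ ≤ k)

nCk≢0 : ∀ {n k} → k ≤ n → NonZero (n C k)
nCk≢0 {n} {zero} _ = >-nonZero (≤-reflexive (sym (trans (nCk≡nC[n∸k] (z≤n {n})) (nCn≡1 n))))
nCk≢0 {suc n} {suc k} (s≤s k≤n) =
  >-nonZero (≤-trans (>-nonZero⁻¹ (n C k) {{nCk≢0 k≤n}})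
    (≤-trans (m≤m+n (n C k) (n C suc k)) (≤-reflexive (nCk+nC[k+1]≡[n+1]C[k+1] n k))))

subsets : (n : ℕ) → List (Subset n)
subsets zero    = [] ∷ []
subsets (suc n) = map (outside ∷_) (subsets n) ++ map (inside ∷_) (subsets n)

weight : {n : ℕ} → Subset n → ℚ
weight {n} A = (1ℤ ℚ./ (n C ∣ A ∣)) {{nCk≢0 (∣p∣≤n A)}}

lubell : {n : ℕ} {F : Family n} → Decidable₁ F → ℚ
lubell {n} F? = foldr ℚ._+_ 0ℚ (map weight (filter F? (subsets n)))

fromℕ : ℕ → ℚ
fromℕ n = + n ℚ./ 1

-- In these definitions the existential quantifier over e only names the number
-- e(P), which exists and is unique for every finite nonempty poset.

_-LBounded_ : ℕ → FinPoset → Set₁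
m -LBounded P = ∃ λ e → IsE P e ×
  (∀ (n : ℕ) (F : Family n) (F? : Decidable₁ F) → Free P F →
   (∀ A → F A → m ≤ ∣ A ∣ × ∣ A ∣ + m ≤ n) →
   lubell F? ℚ.≤ fromℕ e)

UniformlyLBounded : FinPoset → Set₁
UniformlyLBounded P = 0 -LBounded P

LBounded : FinPoset → Set₁
LBounded P = ∃ λ m → m -LBounded P

-- Rational β and ε are as general as real ones: the property for (β , ε)
-- follows from the property for any (β′ , ε′) with β ≤ β′ and ε′ ≤ ε.
LowerLBounded : FinPoset → Set₁
LowerLBounded P = ∃ λ e → IsE P e ×
  (∀ (β ε : ℚ) → ½ ℚ.< β → β ℚ.< 1ℚ → 0ℚ ℚ.< ε →
   ∃ λ N → ∀ (n : ℕ) → N ≤ n → (F : Family n) (F? : Decidable₁ F) → Free P F →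
   (∀ A → F A → fromℕ ∣ A ∣ ℚ.< β ℚ.* fromℕ n) →
   lubell F? ℚ.≤ fromℕ e ℚ.+ ε)

{-# OPTIONS --safe #-}

-- Suppose that ∅ ∈ F, that all members of F have at least t elements in their
-- complement, and that the Lubell value of F exceeds e₁ + T/t with T = Σ |Pᵢ|.
-- Copies of P₁, …, P_k can then be chosen in F one after another, each time
-- deleting the nonempty sets already used (at most 1/t of Lubell value apiece),
-- and moving all the bottoms to ∅ produces the wedge.  If e₁ > e₂ and t ≥ T, it
-- is enough to exceed e₁, since from the second copy on the total cost T/t ≤ 1
-- is covered by e₁ − e₂.  The condition ∅ ∈ F is removed by averaging: without
-- ∅, the Lubell value of F is the average of those of its links at the points.
-- Applied to the lowest e₁ + 1 levels, the bound also yields e(P) = e₁.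

module Submission where

open import Defs
open import Algebra.Bundles using (CommutativeMonoid)
open import Data.Bool.Base using (if_then_else_; true; false)
open import Data.Bool.Properties using () renaming (_≟_ to _≟ᵇ_)
open import Data.Empty using (⊥-elim)
open import Data.Fin.Base using (Fin; zero; suc) renaming (_≤_ to _≤ᶠ_)
open import Data.Fin.Properties using () renaming (_≟_ to _≟ᶠ_)
open import Data.Fin.Subset using (Subset; inside; outside; ∣_∣; ⊥; _⊆_)
open import Data.Fin.Subset.Properties using (∣p∣≤n; ∣⊥∣≡0; drop-∷-⊆; ⊆-antisym; ⊆-min)
open import Data.Integer.Base as ℤ using (+_; -[1+_]; 1ℤ)
import Data.Integer.Properties as ℤ
open import Data.List.Base using (List; []; _∷_; _++_; map; filter; foldr; length; tabulate)
import Data.List.Membership.DecPropositional as DecMembership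
open import Data.List.Membership.Propositional using (_∈_; _∉_)
open import Data.List.Membership.Propositional.Properties using (∈-map⁻; ∈-filter⁺; ∈-filter⁻)
open import Data.List.Properties using (map-++; map-∘; length-map; length-filter)
open import Data.List.Relation.Unary.Any as Any using (here; there)
import Data.List.Relation.Unary.Any.Properties as Any
open import Data.Nat.Base as ℕ using (ℕ; zero; suc; NonZero; s≤s; z≤n; _+_; _*_; _≤_; _<_)
open import Data.Nat.Combinatorics
  using (_C_; nCk≡nC[n∸k]; nCn≡1; nC1≡n; k>n⇒nCk≡0; nCk+nC[k+1]≡[n+1]C[k+1])
open import Data.Nat.ListAction using () renaming (sum to sumₗ)
import Data.Nat.Properties as ℕ
open import Data.Product.Base using (∃; _×_; _,_; proj₁; proj₂)
open import Data.Rational.Base as ℚ using (ℚ; 0ℚ; 1ℚ; ½; toℚᵘ; mkℚ; *<*)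
open import Data.Rational.Properties
open import Algebra.Properties.CommutativeSemigroup (CommutativeMonoid.commutativeSemigroup +-0-commutativeMonoid)
  using (interchange)
open import Algebra.Properties.CommutativeMonoid.Sum +-0-commutativeMonoid using (sum; sum-cong-≗; ∑-distrib-+)
open import Data.Rational.Solver using (module +-*-Solver)
import Data.Rational.Unnormalised.Base as ℚᵘ
import Data.Rational.Unnormalised.Properties as ℚᵘ
open import Data.Vec.Base using ([]; _∷_; insertAt; here; there)
open import Data.Vec.Properties using (≡-dec; ∷-injective)
open import Function.Base using (_∘_; id)
open import Relation.Binary.Morphism.Structures using (IsOrderHomomorphism)
open import Relation.Binary.PropositionalEquality
open import Relation.Nullary using (¬_; Dec; yes; no; does)
open import Relation.Nullary.Decidable using (_×-dec_; ¬?; dec-true; dec-false)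
open import Relation.Unary using () renaming (Decidable to Decidable₁)

private variable m n k : ℕ

-- Rational arithmetic: naturals and their reciprocals.

<⇒≱ : ∀ {p q} → p ℚ.< q → ¬ q ℚ.≤ p
<⇒≱ p<q q≤p = <-irrefl refl (<-≤-trans p<q q≤p)

toℚᵘ-/ : ∀ i n .{{_ : NonZero n}} → toℚᵘ (i ℚ./ n) ℚᵘ.≃ i ℚᵘ./ n
toℚᵘ-/ i (suc n) = toℚᵘ-fromℚᵘ (ℚᵘ.mkℚᵘ i n)

fromℕ-mono-≤ : m ≤ n → fromℕ m ℚ.≤ fromℕ n
fromℕ-mono-≤ {m} {n} m≤n = toℚᵘ-cancel-≤
  (ℚᵘ.≤-respˡ-≃ (ℚᵘ.≃-sym (toℚᵘ-/ (+ m) 1)) (ℚᵘ.≤-respʳ-≃ (ℚᵘ.≃-sym (toℚᵘ-/ (+ n) 1))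
    (ℚᵘ.*≤* (ℤ.*-monoʳ-≤-nonNeg (+ 1) (ℤ.+≤+ m≤n)))))

fromℕ-mono-< : m < n → fromℕ m ℚ.< fromℕ n
fromℕ-mono-< {m} {n} m<n = toℚᵘ-cancel-<
  (ℚᵘ.<-respˡ-≃ (ℚᵘ.≃-sym (toℚᵘ-/ (+ m) 1)) (ℚᵘ.<-respʳ-≃ (ℚᵘ.≃-sym (toℚᵘ-/ (+ n) 1))
    (ℚᵘ.*<* (ℤ.*-monoʳ-<-pos (+ 1) (ℤ.+<+ m<n)))))

fromℕ-+ : ∀ m n → fromℕ (m + n) ≡ fromℕ m ℚ.+ fromℕ n
fromℕ-+ m n = toℚᵘ-injective (begin
  toℚᵘ (fromℕ (m + n))                 ≈⟨ toℚᵘ-/ (+ (m + n)) 1 ⟩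
  (+ (m + n)) ℚᵘ./ 1
    ≈⟨ ℚᵘ.*≡* (cong (ℤ._* + 1) (cong₂ ℤ._+_ (sym (ℤ.*-identityʳ (+ m))) (sym (ℤ.*-identityʳ (+ n))))) ⟩
  ((+ m) ℚᵘ./ 1) ℚᵘ.+ ((+ n) ℚᵘ./ 1)  ≈⟨ ℚᵘ.+-cong (toℚᵘ-/ (+ m) 1) (toℚᵘ-/ (+ n) 1) ⟨
  toℚᵘ (fromℕ m) ℚᵘ.+ toℚᵘ (fromℕ n)  ≈⟨ toℚᵘ-homo-+ (fromℕ m) (fromℕ n) ⟨
  toℚᵘ (fromℕ m ℚ.+ fromℕ n)          ∎)
  where open ℚᵘ.≃-Reasoning

fromℕ-* : ∀ m n → fromℕ (m * n) ≡ fromℕ m ℚ.* fromℕ n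
fromℕ-* m n = toℚᵘ-injective (begin
  toℚᵘ (fromℕ (m * n))                ≈⟨ toℚᵘ-/ (+ (m * n)) 1 ⟩
  (+ (m * n)) ℚᵘ./ 1                  ≈⟨ ℚᵘ.*≡* (cong (ℤ._* + 1) (ℤ.pos-* m n)) ⟩
  ((+ m) ℚᵘ./ 1) ℚᵘ.* ((+ n) ℚᵘ./ 1)  ≈⟨ ℚᵘ.*-cong (toℚᵘ-/ (+ m) 1) (toℚᵘ-/ (+ n) 1) ⟨
  toℚᵘ (fromℕ m) ℚᵘ.* toℚᵘ (fromℕ n)  ≈⟨ toℚᵘ-homo-* (fromℕ m) (fromℕ n) ⟨
  toℚᵘ (fromℕ m ℚ.* fromℕ n)          ∎)
  where open ℚᵘ.≃-Reasoning

fromℕ-suc-* : ∀ n c → fromℕ (suc n) ℚ.* c ≡ c ℚ.+ fromℕ n ℚ.* c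
fromℕ-suc-* n c = trans (cong (ℚ._* c) (fromℕ-+ 1 n))
  (trans (*-distribʳ-+ c 1ℚ (fromℕ n)) (cong (ℚ._+ fromℕ n ℚ.* c) (*-identityˡ c)))

-- Total reciprocal with default value 0 at 0: unlike `ℚ./` it takes no `NonZero` argument, so its
-- argument can be rewritten freely.
inv : ℕ → ℚ
inv zero    = 0ℚ
inv (suc n) = 1ℤ ℚ./ suc n

inv-/ : ∀ n .{{_ : NonZero n}} → 1ℤ ℚ./ n ≡ inv n
inv-/ (suc n) = refl

fromℕ-*-inv : ∀ n .{{_ : NonZero n}} → fromℕ n ℚ.* inv n ≡ 1ℚ
fromℕ-*-inv (suc n) = toℚᵘ-injective (begin
  toℚᵘ (fromℕ (suc n) ℚ.* inv (suc n))          ≈⟨ toℚᵘ-homo-* (fromℕ (suc n)) (inv (suc n)) ⟩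
  toℚᵘ (fromℕ (suc n)) ℚᵘ.* toℚᵘ (inv (suc n))  ≈⟨ ℚᵘ.*-cong (toℚᵘ-/ (+ suc n) 1) (toℚᵘ-/ 1ℤ (suc n)) ⟩
  ((+ suc n) ℚᵘ./ 1) ℚᵘ.* (1ℤ ℚᵘ./ suc n)       ≈⟨ ℚᵘ.*-inverseʳ ((+ suc n) ℚᵘ./ 1) ⟩
  ℚᵘ.1ℚᵘ                                        ∎)
  where open ℚᵘ.≃-Reasoning

0≤inv : ∀ n → 0ℚ ℚ.≤ inv n
0≤inv zero = ≤-refl
0≤inv (suc n) = nonNegative⁻¹ (inv (suc n)) {{normalize-nonNeg 1 (suc n)}}

cross-inv : ∀ a d {c c′} .{{_ : NonZero c}} .{{_ : NonZero c′}} → a * c′ ≡ d * c →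
            fromℕ a ℚ.* inv c ≡ fromℕ d ℚ.* inv c′
cross-inv a d {c} {c′} ac′≡dc = begin
  fromℕ a ℚ.* inv c         ≡⟨ *-identityʳ _ ⟨
  fromℕ a ℚ.* inv c ℚ.* 1ℚ  ≡⟨ cong (fromℕ a ℚ.* inv c ℚ.*_) (fromℕ-*-inv c′) ⟨
  fromℕ a ℚ.* inv c ℚ.* (fromℕ c′ ℚ.* inv c′)
    ≡⟨ solve 4 (λ x y z w → x :* y :* (z :* w) := x :* z :* (y :* w)) refl (fromℕ a) (inv c) (fromℕ c′) (inv c′) ⟩
  fromℕ a ℚ.* fromℕ c′ ℚ.* (inv c ℚ.* inv c′)
    ≡⟨ cong (ℚ._* (inv c ℚ.* inv c′)) (trans (sym (fromℕ-* a c′)) (trans (cong fromℕ ac′≡dc) (fromℕ-* d c))) ⟩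
  fromℕ d ℚ.* fromℕ c ℚ.* (inv c ℚ.* inv c′)
    ≡⟨ solve 4 (λ x y z w → x :* y :* (z :* w) := x :* w :* (y :* z)) refl (fromℕ d) (fromℕ c) (inv c) (inv c′) ⟩
  fromℕ d ℚ.* inv c′ ℚ.* (fromℕ c ℚ.* inv c)  ≡⟨ cong (fromℕ d ℚ.* inv c′ ℚ.*_) (fromℕ-*-inv c) ⟩
  fromℕ d ℚ.* inv c′ ℚ.* 1ℚ                   ≡⟨ *-identityʳ _ ⟩
  fromℕ d ℚ.* inv c′                          ∎
  where open ≡-Reasoning
        open +-*-Solver

inv-antimono-≤ : ∀ {c c′} .{{_ : NonZero c}} → c ≤ c′ → inv c′ ℚ.≤ inv c
inv-antimono-≤ {suc c} {suc c′} c≤c′ = toℚᵘ-cancel-≤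
  (ℚᵘ.≤-respˡ-≃ (ℚᵘ.≃-sym (toℚᵘ-/ 1ℤ (suc c′))) (ℚᵘ.≤-respʳ-≃ (ℚᵘ.≃-sym (toℚᵘ-/ 1ℤ (suc c)))
    (ℚᵘ.*≤* (ℤ.*-monoˡ-≤-nonNeg 1ℤ (ℤ.+≤+ c≤c′)))))

-- Binomial coefficients and weights of sets.

nC0≡1 : ∀ n → n C 0 ≡ 1
nC0≡1 n = trans (nCk≡nC[n∸k] {0} {n} z≤n) (nCn≡1 n)

-- Absorption identity, by induction with Pascal's rule. It compares the weight of a set with its
-- weight in a link.
[k+1]*[n+1]C[k+1]≡[n+1]*nCk : ∀ n k → suc k * (suc n C suc k) ≡ suc n * (n C k)
[k+1]*[n+1]C[k+1]≡[n+1]*nCk zero    zero    = refl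
[k+1]*[n+1]C[k+1]≡[n+1]*nCk zero    (suc k) = trans (cong (suc (suc k) *_) (k>n⇒nCk≡0 {1} {2 + k} (s≤s (s≤s z≤n))))
  (trans (ℕ.*-zeroʳ (2 + k)) (sym (trans (ℕ.*-identityˡ _) (k>n⇒nCk≡0 {0} {suc k} (s≤s z≤n)))))
[k+1]*[n+1]C[k+1]≡[n+1]*nCk (suc n) zero    = begin
  1 * (suc (suc n) C 1)      ≡⟨ ℕ.*-identityˡ _ ⟩
  suc (suc n) C 1            ≡⟨ nC1≡n (suc (suc n)) ⟩
  suc (suc n)                ≡⟨ ℕ.*-identityʳ _ ⟨
  suc (suc n) * 1            ≡⟨ cong (suc (suc n) *_) (nC0≡1 (suc n)) ⟨
  suc (suc n) * (suc n C 0)  ∎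
  where open ≡-Reasoning
[k+1]*[n+1]C[k+1]≡[n+1]*nCk (suc n) (suc k) = begin
  (2 + k) * ((2 + n) C (2 + k))      ≡⟨ cong ((2 + k) *_) (nCk+nC[k+1]≡[n+1]C[k+1] (suc n) (suc k)) ⟨
  (2 + k) * (x + (suc n C (2 + k)))  ≡⟨ ℕ.*-distribˡ-+ (2 + k) x _ ⟩
  x + suc k * x + (2 + k) * (suc n C (2 + k))
    ≡⟨ cong₂ (λ y z → x + y + z) ([k+1]*[n+1]C[k+1]≡[n+1]*nCk n k) ([k+1]*[n+1]C[k+1]≡[n+1]*nCk n (suc k)) ⟩
  x + suc n * (n C k) + suc n * (n C suc k)    ≡⟨ ℕ.+-assoc x _ _ ⟩
  x + (suc n * (n C k) + suc n * (n C suc k))  ≡⟨ cong (x ℕ.+_) (ℕ.*-distribˡ-+ (suc n) (n C k) _) ⟨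
  x + suc n * (n C k + n C suc k)              ≡⟨ cong (λ y → x + suc n * y) (nCk+nC[k+1]≡[n+1]C[k+1] n k) ⟩
  x + suc n * x                                ∎
  where open ≡-Reasoning
        x = suc n C suc k

-- In Pascal's rule one summand is at least `n` by induction and the other is positive. Hence a
-- nonempty proper subset weighs at most 1/n.
n≤nC[k+1] : ∀ {n k} → suc k < n → n ≤ n C suc k
n≤nC[k+1] {suc n} {zero} _ = ℕ.≤-reflexive (sym (nC1≡n (suc n)))
n≤nC[k+1] {suc n} {suc k} (s≤s 1+k<n) = ℕ.≤-trans
  (ℕ.≤-trans (ℕ.≤-reflexive (ℕ.+-comm 1 n)) (ℕ.+-mono-≤ (n≤nC[k+1] 1+k<n) (ℕ.>-nonZero⁻¹ _ {{nCk≢0 1+k<n}})))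
  (ℕ.≤-reflexive (nCk+nC[k+1]≡[n+1]C[k+1] n (suc k)))

weight≡inv : (A : Subset n) → weight A ≡ inv (n C ∣ A ∣)
weight≡inv {n} A = inv-/ (n C ∣ A ∣) {{nCk≢0 (∣p∣≤n A)}}

-- Sums over all subsets, by recursion on the first coordinate.

∑ₛ : ∀ n → (Subset n → ℚ) → ℚ
∑ₛ zero    g = g []
∑ₛ (suc n) g = ∑ₛ n (g ∘ (outside ∷_)) ℚ.+ ∑ₛ n (g ∘ (inside ∷_))

∑ₛ-cong : ∀ n {g h : Subset n → ℚ} → (∀ A → g A ≡ h A) → ∑ₛ n g ≡ ∑ₛ n h
∑ₛ-cong zero    g≗h = g≗h []
∑ₛ-cong (suc n) g≗h = cong₂ ℚ._+_ (∑ₛ-cong n (g≗h ∘ (outside ∷_))) (∑ₛ-cong n (g≗h ∘ (inside ∷_)))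

∑ₛ-mono : ∀ n {g h : Subset n → ℚ} → (∀ A → g A ℚ.≤ h A) → ∑ₛ n g ℚ.≤ ∑ₛ n h
∑ₛ-mono zero    g≤h = g≤h []
∑ₛ-mono (suc n) g≤h = +-mono-≤ (∑ₛ-mono n (g≤h ∘ (outside ∷_))) (∑ₛ-mono n (g≤h ∘ (inside ∷_)))

∑ₛ-+ : ∀ n (g h : Subset n → ℚ) → ∑ₛ n (λ A → g A ℚ.+ h A) ≡ ∑ₛ n g ℚ.+ ∑ₛ n h
∑ₛ-+ zero    g h = refl
∑ₛ-+ (suc n) g h = trans
  (cong₂ ℚ._+_ (∑ₛ-+ n (g ∘ (outside ∷_)) (h ∘ (outside ∷_))) (∑ₛ-+ n (g ∘ (inside ∷_)) (h ∘ (inside ∷_))))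
  (interchange (∑ₛ n (g ∘ (outside ∷_))) (∑ₛ n (h ∘ (outside ∷_)))
               (∑ₛ n (g ∘ (inside ∷_))) (∑ₛ n (h ∘ (inside ∷_))))

*-distribˡ-∑ₛ : ∀ n c (g : Subset n → ℚ) → c ℚ.* ∑ₛ n g ≡ ∑ₛ n (λ A → c ℚ.* g A)
*-distribˡ-∑ₛ zero    c g = refl
*-distribˡ-∑ₛ (suc n) c g = trans (*-distribˡ-+ c _ _) (cong₂ ℚ._+_ (*-distribˡ-∑ₛ n c _) (*-distribˡ-∑ₛ n c _))

∑ₛ-0 : ∀ n → ∑ₛ n (λ _ → 0ℚ) ≡ 0ℚ
∑ₛ-0 zero    = refl
∑ₛ-0 (suc n) = trans (cong₂ ℚ._+_ (∑ₛ-0 n) (∑ₛ-0 n)) (+-identityˡ 0ℚ)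

-- The induction follows the coordinates of `B`; on the half of the cube that misses `B`,
-- monotonicity is enough. This prices the deletion of a single set.
∑ₛ-indicator-≤ : ∀ n {g h : Subset n → ℚ} {c} B → (∀ A → A ≢ B → g A ℚ.≤ h A) → g B ℚ.≤ h B ℚ.+ c →
                 ∑ₛ n g ℚ.≤ ∑ₛ n h ℚ.+ c
∑ₛ-indicator-≤ zero    []      _   g≤h+c = g≤h+c
∑ₛ-indicator-≤ (suc n) {g} {h} {c} (outside ∷ B) g≤h g≤h+c = ≤-trans
  (+-mono-≤ (∑ₛ-indicator-≤ n B (λ A A≢B → g≤h _ (λ { refl → A≢B refl })) g≤h+c)
            (∑ₛ-mono n (λ A → g≤h (inside ∷ A) (λ ()))))
  (≤-reflexive (trans (cong₂ ℚ._+_ (+-comm x c) refl) (trans (+-assoc c x y) (+-comm c (x ℚ.+ y)))))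
  where x = ∑ₛ n (h ∘ (outside ∷_))
        y = ∑ₛ n (h ∘ (inside ∷_))
∑ₛ-indicator-≤ (suc n) {g} {h} {c} (inside ∷ B) g≤h g≤h+c = ≤-trans
  (+-mono-≤ (∑ₛ-mono n (λ A → g≤h (outside ∷ A) (λ ())))
            (∑ₛ-indicator-≤ n B (λ A A≢B → g≤h _ (λ { refl → A≢B refl })) g≤h+c))
  (≤-reflexive (sym (+-assoc (∑ₛ n (h ∘ (outside ∷_))) (∑ₛ n (h ∘ (inside ∷_))) c)))

-- Double counting of pairs of a set and one of its points: `A` arises as `insertAt B x inside`
-- exactly once for each of its points `x`.
∑ₛ-insertAt : ∀ n (g : Subset (suc n) → ℚ) →
              sum (λ x → ∑ₛ n (λ B → g (insertAt B x inside))) ≡ ∑ₛ (suc n) (λ A → fromℕ ∣ A ∣ ℚ.* g A)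
∑ₛ-insertAt zero g =
  solve 2 (λ x y → x :+ con 0ℚ := con 0ℚ :* y :+ con 1ℚ :* x) refl (g (inside ∷ [])) (g (outside ∷ []))
  where open +-*-Solver
∑ₛ-insertAt (suc n) g = begin
  Z ℚ.+ sum (λ x → Sₒ x ℚ.+ Sᵢ x)  ≡⟨ cong (Z ℚ.+_) (∑-distrib-+ Sₒ Sᵢ) ⟩
  Z ℚ.+ (sum Sₒ ℚ.+ sum Sᵢ)        ≡⟨ cong₂ (λ x y → Z ℚ.+ (x ℚ.+ y)) (∑ₛ-insertAt n gₒ) (∑ₛ-insertAt n gᵢ) ⟩
  Z ℚ.+ (X ℚ.+ Y)                  ≡⟨ solve 3 (λ x y z → x :+ (y :+ z) := y :+ (x :+ z)) refl Z X Y ⟩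
  -- `Z` is the share of the point `zero`, which lies in every set seen by `gᵢ`; it raises the
  -- coefficient `∣ A ∣` in `Y` by one.
  X ℚ.+ (Z ℚ.+ Y)                  ≡⟨ cong (X ℚ.+_) (∑ₛ-+ (suc n) gᵢ (λ A → fromℕ ∣ A ∣ ℚ.* gᵢ A)) ⟨
  X ℚ.+ ∑ₛ (suc n) (λ A → gᵢ A ℚ.+ fromℕ ∣ A ∣ ℚ.* gᵢ A)
    ≡⟨ cong (X ℚ.+_) (∑ₛ-cong (suc n) (λ A → sym (fromℕ-suc-* ∣ A ∣ (gᵢ A)))) ⟩
  X ℚ.+ ∑ₛ (suc n) (λ A → fromℕ (suc ∣ A ∣) ℚ.* gᵢ A) ∎
  where
  open ≡-Reasoning
  open +-*-Solver
  gₒ = g ∘ (outside ∷_)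
  gᵢ = g ∘ (inside ∷_)
  Sₒ Sᵢ : Fin (suc n) → ℚ
  Sₒ x = ∑ₛ n (λ B → gₒ (insertAt B x inside))
  Sᵢ x = ∑ₛ n (λ B → gᵢ (insertAt B x inside))
  X  = ∑ₛ (suc n) (λ A → fromℕ ∣ A ∣ ℚ.* gₒ A)
  Y  = ∑ₛ (suc n) (λ A → fromℕ ∣ A ∣ ℚ.* gᵢ A)
  Z  = ∑ₛ (suc n) gᵢ

-- The Lubell function as a sum over all subsets.

summand : {F : Family n} → Decidable₁ F → Subset n → ℚ
summand F? A = if does (F? A) then weight A else 0ℚ

-- Filtering becomes an indicator, and `subsets` splits on the first coordinate exactly as `∑ₛ`
-- does.
lubell≡∑ₛ : {F : Family n} (F? : Decidable₁ F) → lubell F? ≡ ∑ₛ n (summand F?)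
lubell≡∑ₛ {n} F? = trans (filtered weight (subsets n)) (enumerated n (summand F?))
  where
  Σₗ : List ℚ → ℚ
  Σₗ = foldr ℚ._+_ 0ℚ

  filtered : ∀ (w : Subset n → ℚ) As → Σₗ (map w (filter F? As)) ≡ Σₗ (map (λ A → if does (F? A) then w A else 0ℚ) As)
  filtered w []       = refl
  filtered w (A ∷ As) with F? A
  ... | yes _ = cong (w A ℚ.+_) (filtered w As)
  ... | no  _ = trans (filtered w As) (sym (+-identityˡ _))

  Σₗ-++ : ∀ ps qs → Σₗ (ps ++ qs) ≡ Σₗ ps ℚ.+ Σₗ qs
  Σₗ-++ []       qs = sym (+-identityˡ _)
  Σₗ-++ (p ∷ ps) qs = trans (cong (p ℚ.+_) (Σₗ-++ ps qs)) (sym (+-assoc p _ _))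

  enumerated : ∀ n (g : Subset n → ℚ) → Σₗ (map g (subsets n)) ≡ ∑ₛ n g
  enumerated zero    g = +-identityʳ _
  enumerated (suc n) g = begin
    Σₗ (map g (map (outside ∷_) (subsets n) ++ map (inside ∷_) (subsets n)))
      ≡⟨ cong Σₗ (map-++ g (map (outside ∷_) (subsets n)) _) ⟩
    Σₗ (map g (map (outside ∷_) (subsets n)) ++ map g (map (inside ∷_) (subsets n)))
      ≡⟨ Σₗ-++ (map g (map (outside ∷_) (subsets n))) _ ⟩
    Σₗ (map g (map (outside ∷_) (subsets n))) ℚ.+ Σₗ (map g (map (inside ∷_) (subsets n)))
      ≡⟨ cong₂ (λ ps qs → Σₗ ps ℚ.+ Σₗ qs) (map-∘ (subsets n)) (map-∘ (subsets n)) ⟨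
    Σₗ (map (g ∘ (outside ∷_)) (subsets n)) ℚ.+ Σₗ (map (g ∘ (inside ∷_)) (subsets n))
      ≡⟨ cong₂ ℚ._+_ (enumerated n _) (enumerated n _) ⟩
    ∑ₛ n (g ∘ (outside ∷_)) ℚ.+ ∑ₛ n (g ∘ (inside ∷_)) ∎
    where open ≡-Reasoning

-- Links, and the Lubell function in terms of them.

link : Family (suc n) → Fin (suc n) → Family n
link F x B = F (insertAt B x inside)

link? : {F : Family (suc n)} → Decidable₁ F → ∀ x → Decidable₁ (link F x)
link? F? x B = F? (insertAt B x inside)

∣insertAt∣ : (B : Subset n) (x : Fin (suc n)) → ∣ insertAt B x inside ∣ ≡ suc ∣ B ∣
∣insertAt∣ B             zero    = refl
∣insertAt∣ (inside ∷ B)  (suc x) = cong suc (∣insertAt∣ B x)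
∣insertAt∣ (outside ∷ B) (suc x) = ∣insertAt∣ B x

∣p∣≡0⇒p≡⊥ : (A : Subset n) → ∣ A ∣ ≡ 0 → A ≡ ⊥
∣p∣≡0⇒p≡⊥ []            _  = refl
∣p∣≡0⇒p≡⊥ (outside ∷ A) eq = cong (outside ∷_) (∣p∣≡0⇒p≡⊥ A eq)

weight-⊥ : ∀ n → weight (⊥ {n}) ≡ 1ℚ
weight-⊥ n = trans (weight≡inv (⊥ {n})) (cong inv (trans (cong (n C_) (∣⊥∣≡0 n)) (nC0≡1 n)))

-- At `∣ A ∣` this supplies the term of `⊥`, which a sum with coefficients `∣ A ∣` misses.
ifZero : ℚ → ℕ → ℚ
ifZero c zero    = c
ifZero c (suc _) = 0ℚ

∑ₛ-ifZero : ∀ n c → ∑ₛ n (λ A → ifZero c ∣ A ∣) ≡ c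
∑ₛ-ifZero zero    c = refl
∑ₛ-ifZero (suc n) c = trans (cong₂ ℚ._+_ (∑ₛ-ifZero n c) (∑ₛ-0 n)) (+-identityʳ c)

-- This splits the full chains by their second member.
lubell-links : {F : Family (suc n)} (F? : Decidable₁ F) →
  fromℕ (suc n) ℚ.* lubell F? ≡
  fromℕ (suc n) ℚ.* summand F? ⊥ ℚ.+ sum (λ x → lubell (link? F? x))
lubell-links {n} {F} F? = begin
  N ℚ.* lubell F?                        ≡⟨ cong (N ℚ.*_) (lubell≡∑ₛ F?) ⟩
  N ℚ.* ∑ₛ (suc n) (summand F?)          ≡⟨ *-distribˡ-∑ₛ (suc n) N (summand F?) ⟩
  ∑ₛ (suc n) (λ A → N ℚ.* summand F? A)  ≡⟨ ∑ₛ-cong (suc n) (λ A → split A ∣ A ∣ refl) ⟩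
  ∑ₛ (suc n) (λ A → ifZero c ∣ A ∣ ℚ.+ fromℕ ∣ A ∣ ℚ.* g A)
    ≡⟨ ∑ₛ-+ (suc n) (λ A → ifZero c ∣ A ∣) (λ A → fromℕ ∣ A ∣ ℚ.* g A) ⟩
  ∑ₛ (suc n) (λ A → ifZero c ∣ A ∣) ℚ.+ ∑ₛ (suc n) (λ A → fromℕ ∣ A ∣ ℚ.* g A)
    ≡⟨ cong₂ ℚ._+_ (∑ₛ-ifZero (suc n) c) (sym (∑ₛ-insertAt n g)) ⟩
  c ℚ.+ sum (λ x → ∑ₛ n (λ B → g (insertAt B x inside)))
    ≡⟨ cong (c ℚ.+_) (sum-cong-≗ (λ x → trans (∑ₛ-cong n (at x)) (sym (lubell≡∑ₛ (link? F? x))))) ⟩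
  c ℚ.+ sum (λ x → lubell (link? F? x))  ∎
  where
  open ≡-Reasoning
  N = fromℕ (suc n)
  c = N ℚ.* summand F? ⊥
  -- the weight that A has in the links at its elements
  g : Subset (suc n) → ℚ
  g A = if does (F? A) then inv (n C ℕ.pred ∣ A ∣) else 0ℚ

  at : ∀ x B → g (insertAt B x inside) ≡ summand (link? F? x) B
  at x B = cong (λ w → if does (F? (insertAt B x inside)) then w else 0ℚ)
    (trans (cong (λ k → inv (n C ℕ.pred k)) (∣insertAt∣ B x)) (sym (weight≡inv B)))

  split : ∀ A k → ∣ A ∣ ≡ k → N ℚ.* summand F? A ≡ ifZero c ∣ A ∣ ℚ.+ fromℕ ∣ A ∣ ℚ.* g A
  split A zero ∣A∣≡0 = begin
    N ℚ.* summand F? A                      ≡⟨ cong (λ B → N ℚ.* summand F? B) (∣p∣≡0⇒p≡⊥ A ∣A∣≡0) ⟩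
    c                                       ≡⟨ +-identityʳ c ⟨
    c ℚ.+ 0ℚ                                ≡⟨ cong (c ℚ.+_) (*-zeroˡ (g A)) ⟨
    c ℚ.+ fromℕ 0 ℚ.* g A                   ≡⟨ cong (λ j → ifZero c j ℚ.+ fromℕ j ℚ.* g A) ∣A∣≡0 ⟨
    ifZero c ∣ A ∣ ℚ.+ fromℕ ∣ A ∣ ℚ.* g A  ∎
  split A (suc k) ∣A∣≡1+k = begin
    N ℚ.* summand F? A                                           ≡⟨ weighed (does (F? A)) ⟩
    fromℕ (suc k) ℚ.* (if does (F? A) then inv (n C k) else 0ℚ)  ≡⟨ +-identityˡ _ ⟨
    0ℚ ℚ.+ fromℕ (suc k) ℚ.* (if does (F? A) then inv (n C k) else 0ℚ)
      ≡⟨ cong (λ j → ifZero c j ℚ.+ fromℕ j ℚ.* (if does (F? A) then inv (n C ℕ.pred j) else 0ℚ)) ∣A∣≡1+k ⟨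
    ifZero c ∣ A ∣ ℚ.+ fromℕ ∣ A ∣ ℚ.* g A ∎
    where
    k≤n : k ≤ n
    k≤n = ℕ.s≤s⁻¹ (subst (_≤ suc n) ∣A∣≡1+k (∣p∣≤n A))

    weighed : ∀ b → N ℚ.* (if b then weight A else 0ℚ) ≡ fromℕ (suc k) ℚ.* (if b then inv (n C k) else 0ℚ)
    weighed false = trans (*-zeroʳ N) (sym (*-zeroʳ (fromℕ (suc k))))
    weighed true  = begin
      N ℚ.* weight A                 ≡⟨ cong (N ℚ.*_) (trans (weight≡inv A) (cong (λ j → inv (suc n C j)) ∣A∣≡1+k)) ⟩
      -- The absorption identity in reciprocal form: (n+1)/C(n+1,k+1) = (k+1)/C(n,k).
      N ℚ.* inv (suc n C suc k)
        ≡⟨ cross-inv (suc k) (suc n) {{nCk≢0 k≤n}} {{nCk≢0 (s≤s k≤n)}} ([k+1]*[n+1]C[k+1]≡[n+1]*nCk n k) ⟨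
      fromℕ (suc k) ℚ.* inv (n C k)  ∎

-- Nonnegativity and monotonicity of the summands.

_≟ˢ_ : (A B : Subset n) → Dec (A ≡ B)
_≟ˢ_ = ≡-dec _≟ᵇ_

0≤weight : (A : Subset n) → 0ℚ ℚ.≤ weight A
0≤weight {n} A = ≤-trans (0≤inv (n C ∣ A ∣)) (≤-reflexive (sym (weight≡inv A)))

module _ {F : Family n} (F? : Decidable₁ F) where

  summand-∈ : ∀ {A} → F A → summand F? A ≡ weight A
  summand-∈ {A} FA = cong (λ b → if b then weight A else 0ℚ) (dec-true (F? A) FA)

  summand-∉ : ∀ {A} → ¬ F A → summand F? A ≡ 0ℚ
  summand-∉ {A} ¬FA = cong (λ b → if b then weight A else 0ℚ) (dec-false (F? A) ¬FA)

  0≤summand : ∀ A → 0ℚ ℚ.≤ summand F? A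
  0≤summand A = bounded (does (F? A)) (0≤weight A)
    where
    bounded : ∀ b {w} → 0ℚ ℚ.≤ w → 0ℚ ℚ.≤ (if b then w else 0ℚ)
    bounded true  0≤w = 0≤w
    bounded false 0≤w = ≤-refl

  summand≤weight : ∀ A → summand F? A ℚ.≤ weight A
  summand≤weight A = bounded (does (F? A)) (0≤weight A)
    where
    bounded : ∀ b {w} → 0ℚ ℚ.≤ w → (if b then w else 0ℚ) ℚ.≤ w
    bounded true  0≤w = ≤-refl
    bounded false 0≤w = 0≤w

  0≤lubell : 0ℚ ℚ.≤ lubell F?
  0≤lubell = ≤-trans (≤-reflexive (sym (∑ₛ-0 n)))
    (≤-trans (∑ₛ-mono n 0≤summand) (≤-reflexive (sym (lubell≡∑ₛ F?))))

summand-mono : {F G : Family n} (F? : Decidable₁ F) (G? : Decidable₁ G) {A : Subset n} →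
               (F A → G A) → summand F? A ℚ.≤ summand G? A
summand-mono {F = F} {G} F? G? {A} F⇒G = by-cases (F? A)
  where
  by-cases : Dec (F A) → summand F? A ℚ.≤ summand G? A
  by-cases (yes FA) = ≤-reflexive (trans (summand-∈ F? FA) (sym (summand-∈ G? (F⇒G FA))))
  by-cases (no ¬FA) = ≤-trans (≤-reflexive (summand-∉ F? ¬FA)) (0≤summand G? A)

-- Averaging over links.

fromℕ-pos : ∀ n → ℚ.Positive (fromℕ (suc n))
fromℕ-pos n = ℚ.positive {fromℕ (suc n)} (fromℕ-mono-< {0} {suc n} (s≤s z≤n))

sum-≤ : ∀ n {f : Fin n → ℚ} {c} → (∀ i → f i ℚ.≤ c) → sum f ℚ.≤ fromℕ n ℚ.* c
sum-≤ zero    {c = c} f≤c = ≤-reflexive (sym (*-zeroˡ c))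
sum-≤ (suc n) {c = c} f≤c = ≤-trans (+-mono-≤ (f≤c zero) (sum-≤ n (f≤c ∘ suc))) (≤-reflexive (sym (fromℕ-suc-* n c)))

sum-≥ : ∀ n {f : Fin n → ℚ} {c} → (∀ i → c ℚ.≤ f i) → fromℕ n ℚ.* c ℚ.≤ sum f
sum-≥ zero    {c = c} c≤f = ≤-reflexive (*-zeroˡ c)
sum-≥ (suc n) {c = c} c≤f = ≤-trans (≤-reflexive (fromℕ-suc-* n c)) (+-mono-≤ (c≤f zero) (sum-≥ n (c≤f ∘ suc)))

module _ {F : Family (suc n)} (F? : Decidable₁ F) {c : ℚ} where

  private
    N = fromℕ (suc n)
    s = summand F? ⊥

  -- Dividing `lubell-links` by n + 1 shows that the Lubell value is the term of `⊥` plus the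
  -- average over the links.
  lubell-links-≤ : (∀ x → lubell (link? F? x) ℚ.≤ c) → lubell F? ℚ.≤ s ℚ.+ c
  lubell-links-≤ links≤c = *-cancelˡ-≤-pos N {{fromℕ-pos n}} (begin
    N ℚ.* lubell F?                              ≡⟨ lubell-links F? ⟩
    N ℚ.* s ℚ.+ sum (λ x → lubell (link? F? x))  ≤⟨ +-monoʳ-≤ (N ℚ.* s) (sum-≤ (suc n) links≤c) ⟩
    N ℚ.* s ℚ.+ N ℚ.* c                          ≡⟨ *-distribˡ-+ N s c ⟨
    N ℚ.* (s ℚ.+ c)                              ∎)
    where open ≤-Reasoning

  lubell-links-≥ : (∀ x → c ℚ.≤ lubell (link? F? x)) → s ℚ.+ c ℚ.≤ lubell F?
  lubell-links-≥ c≤links = *-cancelˡ-≤-pos N {{fromℕ-pos n}} (begin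
    N ℚ.* (s ℚ.+ c)                              ≡⟨ *-distribˡ-+ N s c ⟩
    N ℚ.* s ℚ.+ N ℚ.* c                          ≤⟨ +-monoʳ-≤ (N ℚ.* s) (sum-≥ (suc n) c≤links) ⟩
    N ℚ.* s ℚ.+ sum (λ x → lubell (link? F? x))  ≡⟨ lubell-links F? ⟨
    N ℚ.* lubell F?                              ∎)
    where open ≤-Reasoning

-- Induction on `n`: a family without `⊥` is bounded by its links, which inherit `Q`. When no points
-- are left, a family without `⊥` is empty and `0 ≤ c` applies.
lubell-≤-of-⊥∈ : (Q : ∀ {n} → Family n → Set) {c : ℚ} → 0ℚ ℚ.≤ c →
  (∀ {n} {F : Family (suc n)} x → Q F → Q (link F x)) →
  (∀ {n} {F : Family n} (F? : Decidable₁ F) → Q F → F ⊥ → lubell F? ℚ.≤ c) →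
  ∀ n {F : Family n} (F? : Decidable₁ F) → Q F → lubell F? ℚ.≤ c
lubell-≤-of-⊥∈ Q {c} 0≤c Q-link Q-⊥ n {F} F? QF = by-cases n F? QF (F? ⊥)
  where
  by-cases : ∀ n {F : Family n} (F? : Decidable₁ F) → Q F → Dec (F ⊥) → lubell F? ℚ.≤ c
  by-cases n       F? QF (yes F⊥) = Q-⊥ F? QF F⊥
  by-cases zero    F? QF (no ¬F⊥) =
    ≤-trans (≤-reflexive (trans (lubell≡∑ₛ F?) (summand-∉ F? ¬F⊥))) 0≤c
  by-cases (suc n) F? QF (no ¬F⊥) = ≤-trans
    (lubell-links-≤ F? (λ x → by-cases n (link? F? x) (Q-link x QF) (link? F? x ⊥)))
    (≤-reflexive (trans (cong (ℚ._+ c) (summand-∉ F? ¬F⊥)) (+-identityˡ c)))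

-- A full chain has `k` members of size below `k`, as `k ≤ suc n`. In the induction `⊥` contributes
-- 1 and each link keeps its lowest `k - 1` levels.
lubell-≥-of-levels : ∀ n k {F : Family n} (F? : Decidable₁ F) → k ≤ suc n →
  (∀ A → ∣ A ∣ < k → F A) → fromℕ k ℚ.≤ lubell F?
lubell-≥-of-levels n       zero    F? k≤1+n         F-below = 0≤lubell F?
lubell-≥-of-levels zero    (suc .zero) F? (s≤s z≤n) F-below =
  ≤-reflexive (sym (trans (lubell≡∑ₛ F?) (trans (summand-∈ F? (F-below [] (s≤s z≤n))) (weight-⊥ 0))))
lubell-≥-of-levels (suc n) (suc k) F? (s≤s k≤1+n)   F-below = ≤-trans
  (≤-reflexive (trans (fromℕ-+ 1 k) (cong (ℚ._+ fromℕ k) (sym (trans (summand-∈ F? F⊥) (weight-⊥ (suc n)))))))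
  (lubell-links-≥ F? (λ x → lubell-≥-of-levels n k (link? F? x) k≤1+n
    (λ B ∣B∣<k → F-below _ (subst (_< suc k) (sym (∣insertAt∣ B x)) (s≤s ∣B∣<k)))))
  where F⊥ = F-below ⊥ (subst (_< suc k) (sym (∣⊥∣≡0 (suc n))) (s≤s z≤n))

-- Deleting finitely many sets from a family.

_∖_ : Family n → List (Subset n) → Family n
(F ∖ L) A = F A × A ∉ L

_∖?_ : {F : Family n} → Decidable₁ F → ∀ L → Decidable₁ (F ∖ L)
(F? ∖? L) A = F? A ×-dec ¬? (A ∈? L)
  where open DecMembership _≟ˢ_ using (_∈?_)

-- The sets of `L` are deleted one at a time, each at a cost of at most `w`; repetitions and sets
-- outside `F` only loosen the bound.
lubell-∖ : {F : Family n} (F? : Decidable₁ F) {w : ℚ} (L : List (Subset n)) →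
           (∀ {B} → B ∈ L → weight B ℚ.≤ w) →
           lubell F? ℚ.≤ lubell (F? ∖? L) ℚ.+ fromℕ (length L) ℚ.* w
lubell-∖ {n} {F} F? {w} [] _ = ≤-trans
  (subst₂ ℚ._≤_ (sym (lubell≡∑ₛ F?)) (sym (lubell≡∑ₛ (F? ∖? [])))
    (∑ₛ-mono n (λ A → summand-mono F? (F? ∖? []) (λ FA → FA , λ ()))))
  (≤-reflexive (sym (trans (cong (lubell (F? ∖? []) ℚ.+_) (*-zeroˡ w)) (+-identityʳ _))))
lubell-∖ {n} {F} F? {w} (B ∷ L) L≤w = begin
  lubell F?                                                ≤⟨ lubell-∖ F? L (L≤w ∘ there) ⟩
  lubell (F? ∖? L) ℚ.+ l                                   ≡⟨ cong (ℚ._+ l) (lubell≡∑ₛ (F? ∖? L)) ⟩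
  ∑ₛ n (summand (F? ∖? L)) ℚ.+ l                           ≤⟨ +-monoˡ-≤ l (∑ₛ-indicator-≤ n B elsewhere at-B) ⟩
  ∑ₛ n (summand (F? ∖? (B ∷ L))) ℚ.+ w ℚ.+ l               ≡⟨ cong (λ s → s ℚ.+ w ℚ.+ l) (lubell≡∑ₛ (F? ∖? (B ∷ L))) ⟨
  lubell (F? ∖? (B ∷ L)) ℚ.+ w ℚ.+ l                       ≡⟨ +-assoc (lubell (F? ∖? (B ∷ L))) w l ⟩
  lubell (F? ∖? (B ∷ L)) ℚ.+ (w ℚ.+ l)                     ≡⟨ cong (lubell (F? ∖? (B ∷ L)) ℚ.+_) (fromℕ-suc-* (length L) w) ⟨
  lubell (F? ∖? (B ∷ L)) ℚ.+ fromℕ (length (B ∷ L)) ℚ.* w  ∎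
  where
  open ≤-Reasoning
  l = fromℕ (length L) ℚ.* w

  elsewhere : ∀ A → A ≢ B → summand (F? ∖? L) A ℚ.≤ summand (F? ∖? (B ∷ L)) A
  elsewhere A A≢B = summand-mono (F? ∖? L) (F? ∖? (B ∷ L))
    λ { (FA , A∉L) → FA , λ { (here A≡B) → A≢B A≡B ; (there A∈L) → A∉L A∈L } }

  at-B : summand (F? ∖? L) B ℚ.≤ summand (F? ∖? (B ∷ L)) B ℚ.+ w
  at-B = begin
    summand (F? ∖? L) B              ≤⟨ summand≤weight (F? ∖? L) B ⟩
    weight B                         ≤⟨ L≤w (here refl) ⟩
    w                                ≡⟨ +-identityˡ w ⟨
    0ℚ ℚ.+ w                         ≤⟨ +-monoˡ-≤ w (0≤summand (F? ∖? (B ∷ L)) B) ⟩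
    summand (F? ∖? (B ∷ L)) B ℚ.+ w  ∎

-- Since `t` is positive, the size of `A` lies strictly between 0 and `n`, so the binomial
-- coefficient is at least `n`, hence at least `t`.
weight-≤ : ∀ {t} .{{_ : NonZero t}} (A : Subset n) → A ≢ ⊥ → ∣ A ∣ + t ≤ n → weight A ℚ.≤ inv t
weight-≤ {n} {t@(suc _)} A A≢⊥ ∣A∣+t≤n = sized ∣ A ∣ refl
  where
  sized : ∀ a → ∣ A ∣ ≡ a → weight A ℚ.≤ inv t
  sized zero    ∣A∣≡0   = ⊥-elim (A≢⊥ (∣p∣≡0⇒p≡⊥ A ∣A∣≡0))
  sized (suc a) ∣A∣≡1+a = ≤-trans
    (≤-reflexive (trans (weight≡inv A) (cong (λ a → inv (n C a)) ∣A∣≡1+a)))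
    (inv-antimono-≤ (ℕ.≤-trans (ℕ.≤-trans (ℕ.m≤n+m t (suc a)) 1+a+t≤n)
      (n≤nC[k+1] (ℕ.≤-trans (ℕ.m<m+n (suc a) (s≤s z≤n)) 1+a+t≤n))))
    where 1+a+t≤n : suc a + t ≤ n
          1+a+t≤n = subst (λ a → a + t ≤ n) ∣A∣≡1+a ∣A∣+t≤n

-- Copies of posets in families and in links.

insertAt-⊆ : {A B : Subset n} (x : Fin (suc n)) → A ⊆ B → insertAt A x inside ⊆ insertAt B x inside
insertAt-⊆ zero A⊆B here        = here
insertAt-⊆ zero A⊆B (there y∈A) = there (A⊆B y∈A)
insertAt-⊆ {A = a ∷ A} {b ∷ B} (suc x) A⊆B here with here ← A⊆B here = here
insertAt-⊆ {A = a ∷ A} {b ∷ B} (suc x) A⊆B (there y∈A) = there (insertAt-⊆ x (drop-∷-⊆ A⊆B) y∈A)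

insertAt-injective : {A B : Subset n} (x : Fin (suc n)) → insertAt A x inside ≡ insertAt B x inside → A ≡ B
insertAt-injective zero eq = ∷-injective eq .proj₂
insertAt-injective {A = a ∷ A} {b ∷ B} (suc x) eq with refl , eq′ ← ∷-injective eq =
  cong (a ∷_) (insertAt-injective x eq′)

private module P = FinPoset

containedIn-⊆ : {P : FinPoset} {F G : Family n} → (∀ {A} → F A → G A) → P ContainedIn F → P ContainedIn G
containedIn-⊆ F⊆G φ = record
  { f           = f
  ; f-member    = F⊆G ∘ f-member
  ; f-monotone  = f-monotone
  ; f-injective = f-injective
  }
  where open _ContainedIn_ φ

-- Adding `x` to every set of a copy keeps inclusions and distinctness. In the contrapositive,
-- freeness passes to links.
containedIn-link : {P : FinPoset} {F : Family (suc n)} (x : Fin (suc n)) → P ContainedIn link F x → P ContainedIn F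
containedIn-link x φ = record
  { f           = λ u → insertAt (f u) x inside
  ; f-member    = f-member
  ; f-monotone  = record
    { cong = λ u≈v → cong (λ A → insertAt A x inside) (f-monotone .IsOrderHomomorphism.cong u≈v)
    ; mono = λ u≤v → insertAt-⊆ x (f-monotone .IsOrderHomomorphism.mono u≤v)
    }
  ; f-injective = f-injective ∘ insertAt-injective x
  }
  where open _ContainedIn_ φ

module ContainedIn {P : FinPoset} {F : Family n} (φ : P ContainedIn F) where
  open _ContainedIn_ φ public
  open IsOrderHomomorphism f-monotone public using () renaming (cong to f-cong; mono to f-mono)

  -- By monotonicity `f 0̂ ⊆ f x`, so an empty `f x` would force `f 0̂` to be empty too, against
  -- injectivity.
  f≢⊥ : (bot : HasBottom P) → ∀ {x} → ¬ P._≈_ P x (proj₁ bot) → f x ≢ ⊥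
  f≢⊥ (0̂ , 0̂≤) {x} x≉0̂ fx≡⊥ = x≉0̂ (f-injective (trans fx≡⊥ (sym f0̂≡⊥)))
    where f0̂≡⊥ : f 0̂ ≡ ⊥
          f0̂≡⊥ = ⊆-antisym (subst (f 0̂ ⊆_) fx≡⊥ (f-mono (0̂≤ x))) (⊆-min (f 0̂))

  -- ∅ is spared: its weight is 1, and an element at ∅ is a bottom.
  nonemptyImages : List (Subset n)
  nonemptyImages = filter (λ A → ¬? (A ≟ˢ ⊥)) (map f (P.elements P))

  ∈-nonemptyImages : ∀ {x} → f x ≢ ⊥ → f x ∈ nonemptyImages
  ∈-nonemptyImages {x} fx≢⊥ = ∈-filter⁺ (λ A → ¬? (A ≟ˢ ⊥)) (Any.map⁺ (Any.map f-cong (P.complete P x))) fx≢⊥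

  nonemptyImages-member : ∀ {A} → A ∈ nonemptyImages → F A × A ≢ ⊥
  nonemptyImages-member A∈ with A∈images , A≢⊥ ← ∈-filter⁻ (λ A → ¬? (A ≟ˢ ⊥)) {xs = map f (P.elements P)} A∈
    with x , _ , refl ← ∈-map⁻ f A∈images = f-member x , A≢⊥

  length-nonemptyImages : length nonemptyImages ≤ length (P.elements P)
  length-nonemptyImages = ℕ.≤-trans (length-filter (λ A → ¬? (A ≟ˢ ⊥)) (map f (P.elements P)))
    (ℕ.≤-reflexive (length-map f (P.elements P)))

-- Greedy choice of disjoint copies.

size : FinPoset → ℕ
size P = length (P.elements P)

-- Prefix sums. For `size ∘ P` they bound the number of sets deleted before the copy of `P i` is
-- chosen.
before : (Fin k → ℕ) → Fin k → ℕ
before p zero    = 0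
before p (suc i) = p zero + before (p ∘ suc) i

-- The images of the bottoms are unconstrained and may even meet other copies, since the gluing
-- moves them all to `⊥`.
record DisjointCopies (P : Fin k → FinPoset) (bot : ∀ i → HasBottom (P i)) (F : Family n) : Set where
  field
    copy     : ∀ i → P i ContainedIn F
    disjoint : ∀ {i j x y} → i ≢ j → ¬ P._≈_ (P i) x (proj₁ (bot i)) → ¬ P._≈_ (P j) y (proj₁ (bot j)) →
               _ContainedIn_.f (copy i) x ≢ _ContainedIn_.f (copy j) y

LubellBound : FinPoset → ℕ → Set₁
LubellBound P e = ∀ {n} {F : Family n} (F? : Decidable₁ F) → Free P F → lubell F? ℚ.≤ fromℕ e

-- Induction on the number of posets: the threshold of the first yields a copy of it, and what
-- survives the deletion of its nonempty sets still exceeds the later thresholds. The double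
-- negation is there because the bounds only refute freeness and exhibit no copy.
disjointCopies : (P : Fin k → FinPoset) (bot : ∀ i → HasBottom (P i)) (e : Fin k → ℕ) →
  (∀ i → LubellBound (P i) (e i)) →
  {F : Family n} (F? : Decidable₁ F) {w : ℚ} → 0ℚ ℚ.≤ w →
  (∀ {A} → F A → A ≢ ⊥ → weight A ℚ.≤ w) →
  (∀ i → fromℕ (e i) ℚ.+ fromℕ (before (size ∘ P) i) ℚ.* w ℚ.< lubell F?) →
  ¬ ¬ DisjointCopies P bot F
disjointCopies {zero}  P bot e bound F? 0≤w F≤w large none =
  none (record { copy = λ () ; disjoint = λ { {()} } })
disjointCopies {suc k} {n} P bot e bound {F} F? {w} 0≤w F≤w large none =
  <⇒≱ (≤-<-trans (≤-reflexive e₀≡) (large zero)) (bound zero F? without)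
  where
  e₀≡ : fromℕ (e zero) ≡ fromℕ (e zero) ℚ.+ 0ℚ ℚ.* w
  e₀≡ = sym (trans (cong (fromℕ (e zero) ℚ.+_) (*-zeroˡ w)) (+-identityʳ _))

  -- Under the assumption `none`, a copy of `P zero` is absurd because the induction would extend it
  -- to a full system; so `F` is free of `P zero`, against its bound.
  without : Free (P zero) F
  without φ = disjointCopies (P ∘ suc) (bot ∘ suc) (e ∘ suc) (bound ∘ suc) (F? ∖? L) 0≤w
    (F≤w ∘ proj₁) large′ (λ copies → none (extend copies))
    where
    open ContainedIn φ
    L = nonemptyImages
    p = fromℕ (size (P zero)) ℚ.* w
    instance
      w-nonNeg : ℚ.NonNegative w
      w-nonNeg = ℚ.nonNegative 0≤w

    removed : lubell F? ℚ.≤ lubell (F? ∖? L) ℚ.+ p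
    removed = ≤-trans
      (lubell-∖ F? L (λ B∈L → F≤w (nonemptyImages-member B∈L .proj₁) (nonemptyImages-member B∈L .proj₂)))
      (+-monoʳ-≤ (lubell (F? ∖? L)) (*-monoʳ-≤-nonNeg w (fromℕ-mono-≤ length-nonemptyImages)))

    large′ : ∀ i → fromℕ (e (suc i)) ℚ.+ fromℕ (before (size ∘ P ∘ suc) i) ℚ.* w ℚ.< lubell (F? ∖? L)
    -- If the rest met only the shifted threshold, adding back the cost `p` of the first copy would
    -- put `F` at or below its own threshold for `suc i`.
    large′ i = ≰⇒> λ small → <⇒≱ (large (suc i)) (begin
      lubell F?               ≤⟨ removed ⟩
      lubell (F? ∖? L) ℚ.+ p  ≤⟨ +-monoˡ-≤ p small ⟩
      e′ ℚ.+ b ℚ.* w ℚ.+ p    ≡⟨ +-assoc e′ (b ℚ.* w) p ⟩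
      e′ ℚ.+ (b ℚ.* w ℚ.+ p)                 ≡⟨ cong (e′ ℚ.+_)
        (trans (+-comm (b ℚ.* w) p) (sym (*-distribʳ-+ w (fromℕ (size (P zero))) b))) ⟩
      e′ ℚ.+ (fromℕ (size (P zero)) ℚ.+ b) ℚ.* w
        ≡⟨ cong (λ q → e′ ℚ.+ q ℚ.* w) (fromℕ-+ (size (P zero)) (before (size ∘ P ∘ suc) i)) ⟨
      e′ ℚ.+ fromℕ (before (size ∘ P) (suc i)) ℚ.* w ∎)
      where open ≤-Reasoning
            e′ = fromℕ (e (suc i))
            b = fromℕ (before (size ∘ P ∘ suc) i)

    extend : DisjointCopies (P ∘ suc) (bot ∘ suc) (F ∖ L) → DisjointCopies P bot F
    extend copies = record { copy = copy′ ; disjoint = disjoint′ }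
      where
      open DisjointCopies copies
      copy′ : ∀ i → P i ContainedIn F
      copy′ zero    = φ
      copy′ (suc i) = containedIn-⊆ proj₁ (copy i)

      -- Later copies live in `F ∖ L`, while a nonbottom image of `φ` is nonempty and hence in `L`.
      fresh : ∀ {x} i y → ¬ P._≈_ (P zero) x (proj₁ (bot zero)) → f x ≢ _ContainedIn_.f (copy i) y
      fresh i y x≉0̂ fx≡fy = _ContainedIn_.f-member (copy i) y .proj₂
        (subst (_∈ L) fx≡fy (∈-nonemptyImages (f≢⊥ (bot zero) x≉0̂)))

      disjoint′ : ∀ {i j x y} → i ≢ j → ¬ P._≈_ (P i) x (proj₁ (bot i)) → ¬ P._≈_ (P j) y (proj₁ (bot j)) →
                  _ContainedIn_.f (copy′ i) x ≢ _ContainedIn_.f (copy′ j) y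
      disjoint′ {zero}  {zero}          i≢j _   _   = ⊥-elim (i≢j refl)
      disjoint′ {zero}  {suc j} {x} {y} _   x≉0̂ _   = fresh j y x≉0̂
      disjoint′ {suc i} {zero}  {x} {y} _   _   y≉0̂ = fresh i x y≉0̂ ∘ sym
      disjoint′ {suc i} {suc j}         i≢j x≉0̂ y≉0̂ = disjoint (i≢j ∘ cong suc) x≉0̂ y≉0̂

-- Gluing disjoint copies at the empty set.

module _ (P : Fin (suc k) → FinPoset) (bot : ∀ i → HasBottom (P i)) {F : Family n} (F⊥ : F ⊥)
         (copies : DisjointCopies P bot F) where
  open DisjointCopies copies
  open Wedge P bot using (0̂; Carrierᵂ; _≈ᵂ_; glue; within; _≤ᵂ_; bottom)

  private
    module Q i = FinPoset (P i)
    module φ i = ContainedIn (copy i)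

    -- The decision is an argument so that abstracting it with `with` makes `g` compute.
    place : ∀ i (x : Q.Carrier i) → Dec (Q._≈_ i x (0̂ i)) → Subset n
    place i x (yes _) = ⊥
    place i x (no _)  = φ.f i x

    g : Carrierᵂ → Subset n
    g (i , x) = place i x (Q._≟_ i x (0̂ i))

    below-0̂ : ∀ i {x y} → Q._⊑_ i x y → Q._≈_ i y (0̂ i) → Q._≈_ i x (0̂ i)
    below-0̂ i x≤y y≈0 = Q.antisym i (Q.⊑-trans i x≤y (Q.⊑-reflexive i y≈0)) (proj₂ (bot i) _)

    g-member : ∀ u → F (g u)
    g-member (i , x) with Q._≟_ i x (0̂ i)
    ... | yes _ = F⊥
    ... | no  _ = φ.f-member i x

    g-mono : ∀ {u v} → u ≤ᵂ v → g u ⊆ g v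
    g-mono {i , x} {j , y} u≤v with Q._≟_ i x (0̂ i) | Q._≟_ j y (0̂ j) | u≤v
    ... | yes _  | yes _  | _          = ⊆-min _
    ... | yes _  | no _   | _          = ⊆-min _
    ... | no x≉0 | _      | bottom x≈0 = ⊥-elim (x≉0 x≈0)
    ... | no x≉0 | yes y≈0 | within x≤y = ⊥-elim (x≉0 (below-0̂ i x≤y y≈0))
    ... | no _   | no _   | within x≤y = φ.f-mono i x≤y

    -- Only bottoms go to `⊥`, by `f≢⊥`, and these are equal in the wedge. Other elements are
    -- separated by injectivity within a copy and by `disjoint` between copies.
    g-injective : ∀ {u v} → g u ≡ g v → u ≈ᵂ v
    g-injective {i , x} {j , y} gu≡gv with Q._≟_ i x (0̂ i) | Q._≟_ j y (0̂ j) | i ≟ᶠ j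
    ... | yes x≈0 | yes y≈0 | _        = glue x≈0 y≈0
    ... | yes _   | no y≉0  | _        = ⊥-elim (φ.f≢⊥ j (bot j) y≉0 (sym gu≡gv))
    ... | no x≉0  | yes _   | _        = ⊥-elim (φ.f≢⊥ i (bot i) x≉0 gu≡gv)
    ... | no _    | no _    | yes refl = within (φ.f-injective i gu≡gv)
    ... | no x≉0  | no y≉0  | no i≢j   = ⊥-elim (disjoint i≢j x≉0 y≉0 gu≡gv)

  wedge-containedIn : wedge P bot ContainedIn F
  wedge-containedIn = record
    { f           = g
    ; f-member    = g-member
    ; f-monotone  = record
      { cong = λ u≈v → ⊆-antisym (g-mono (W.⊑-reflexive u≈v)) (g-mono (W.⊑-reflexive (W.Eq.sym u≈v)))
      ; mono = g-mono
      }
    ; f-injective = g-injective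
    }
    where module W = FinPoset (wedge P bot)

-- The Lubell bound for wedge-free families.

before-≤ : (p : Fin k → ℕ) (i : Fin k) → before p i ≤ sumₗ (tabulate p)
before-≤ p zero    = z≤n
before-≤ p (suc i) = ℕ.+-monoʳ-≤ (p zero) (before-≤ (p ∘ suc) i)

-- A link loses one point from its sets and from the ground set alike, so the same `t`, and with it
-- the weight bound 1/t, survives however far `n` shrinks.
Codepth≥ : ℕ → Family n → Set
Codepth≥ {n} t F = ∀ A → F A → ∣ A ∣ + t ≤ n

module _ (P : Fin (suc k) → FinPoset) (bot : ∀ i → HasBottom (P i)) (e : Fin (suc k) → ℕ)
         (bound : ∀ i → LubellBound (P i) (e i)) where

  -- Both hypotheses on `F` pass to links, so `⊥` may be assumed to be a member; a value above `c`
  -- then gives disjoint copies to glue. The constant `c` stays open because it is e₀ + T/t in one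
  -- application and e₀ in another.
  lubell-≤-of-wedge-free : ∀ t .{{_ : NonZero t}} {c : ℚ} →
    (∀ i → fromℕ (e i) ℚ.+ fromℕ (before (size ∘ P) i) ℚ.* inv t ℚ.≤ c) →
    {F : Family n} (F? : Decidable₁ F) → Free (wedge P bot) F → Codepth≥ t F → lubell F? ℚ.≤ c
  lubell-≤-of-wedge-free {n} t {c} e+before≤c F? free codepth =
    lubell-≤-of-⊥∈ (λ F → Free (wedge P bot) F × Codepth≥ t F) 0≤c
      (λ { {n} {F} x (free , codepth) →
         (free ∘ containedIn-link x) ,
         λ B FB → ℕ.s≤s⁻¹ (subst (λ b → b + t ≤ suc n) (∣insertAt∣ B x) (codepth _ FB)) })
      (λ { F? (free , codepth) F⊥ → ≮⇒≥ λ c<h →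
         disjointCopies P bot e bound F? (0≤inv t)
           (λ {A} FA A≢⊥ → weight-≤ A A≢⊥ (codepth A FA))
           (λ i → ≤-<-trans (e+before≤c i) c<h)
           (free ∘ wedge-containedIn P bot F⊥) })
      n F? (free , codepth)
    where
    0≤c : 0ℚ ℚ.≤ c
    0≤c = ≤-trans (≤-trans (fromℕ-mono-≤ {0} {e zero} z≤n)
      (≤-reflexive (sym (trans (cong (fromℕ (e zero) ℚ.+_) (*-zeroˡ (inv t))) (+-identityʳ (fromℕ (e zero)))))))
      (e+before≤c zero)

-- With `t = suc T` all deletions together cost less than 1, the least gap between distinct values
-- of e.
fromℕ-*-inv-suc<1 : ∀ m → fromℕ m ℚ.* inv (suc m) ℚ.< 1ℚ
fromℕ-*-inv-suc<1 m = <-≤-trans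
  (*-monoˡ-<-pos (inv (suc m)) {{normalize-pos 1 (suc m)}} (fromℕ-mono-< (ℕ.n<1+n m)))
  (≤-reflexive (fromℕ-*-inv (suc m)))

-- The value of e at the wedge, and its two kinds of boundedness.

module _ (P : Fin (suc k) → FinPoset) (bot : ∀ i → HasBottom (P i))
         (e : Fin (suc k) → ℕ) (isE : ∀ i → IsE (P i) (e i))
         (bound : ∀ i → LubellBound (P i) (e i)) (e≤e₀ : ∀ i → e i ≤ e zero) where

  private
    T = sumₗ (tabulate (size ∘ P))

  e+before≤ : ∀ t i → fromℕ (e i) ℚ.+ fromℕ (before (size ∘ P) i) ℚ.* inv t ℚ.≤ fromℕ (e zero) ℚ.+ fromℕ T ℚ.* inv t
  e+before≤ t i = +-mono-≤ (fromℕ-mono-≤ (e≤e₀ i))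
    (*-monoʳ-≤-nonNeg (inv t) {{ℚ.nonNegative (0≤inv t)}} (fromℕ-mono-≤ (before-≤ (size ∘ P) i)))

  -- A copy of the wedge restricts to a copy of `P zero`; elements that are equal in the wedge by
  -- gluing are both bottoms of `P zero`.
  wedge-levelsFree : LevelsFree (wedge P bot) (e zero)
  wedge-levelsFree n s φ = isE zero .proj₁ n s record
    { f           = λ x → f (zero , x)
    ; f-member    = λ x → f-member (zero , x)
    ; f-monotone  = record { cong = λ x≈y → f-cong (within x≈y) ; mono = λ x≤y → f-mono (within x≤y) }
    ; f-injective = λ fx≡fy → unglue (f-injective fx≡fy)
    }
    where
    open ContainedIn φ
    open Wedge P bot using (_≈ᵂ_; glue; within)
    module P₀ = FinPoset (P zero)
    unglue : ∀ {x y} → (zero , x) ≈ᵂ (zero , y) → x P₀.≈ y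
    unglue (glue x≈0 y≈0) = P₀.Eq.trans x≈0 (P₀.Eq.sym y≈0)
    unglue (within x≈y)   = x≈y

  -- If k′ > e₀ levels were always wedge-free, the lowest k′ of them would have Lubell value at
  -- least e₀ + 1, but the bound is e₀ + T/(T+1).
  wedge-isE : IsE (wedge P bot) (e zero)
  wedge-isE = wedge-levelsFree , λ k′ free → ℕ.≮⇒≥ λ e₀<k′ → absurd k′ free e₀<k′
    where
    t = suc T
    absurd : ∀ k′ → LevelsFree (wedge P bot) k′ → ¬ e zero < k′
    absurd k′ free e₀<k′ = <⇒≱ below above
      where
      -- The ground set has `t` points beyond `k′`, so that these levels have codepth at least `t`.
      F : Family (k′ + t)
      F A = ∣ A ∣ < k′
      F? : Decidable₁ F
      F? A = ∣ A ∣ ℕ.<? k′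
      above : fromℕ (suc (e zero)) ℚ.≤ lubell F?
      above = ≤-trans (fromℕ-mono-≤ e₀<k′)
        (lubell-≥-of-levels (k′ + t) k′ F? (ℕ.≤-trans (ℕ.m≤m+n k′ t) (ℕ.n≤1+n _)) (λ _ → id))
      below : lubell F? ℚ.< fromℕ (suc (e zero))
      below = begin-strict
        lubell F?
          ≤⟨ lubell-≤-of-wedge-free P bot e bound t (e+before≤ t) F?
               (free (k′ + t) (+ 0) ∘ containedIn-⊆ (λ A<k′ → ℤ.+≤+ z≤n , ℤ.+<+ A<k′))
               (λ A ∣A∣<k′ → ℕ.+-monoˡ-≤ t (ℕ.<⇒≤ ∣A∣<k′)) ⟩
        fromℕ (e zero) ℚ.+ fromℕ T ℚ.* inv t  <⟨ +-monoʳ-< (fromℕ (e zero)) (fromℕ-*-inv-suc<1 T) ⟩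
        fromℕ (e zero) ℚ.+ 1ℚ                 ≡⟨ trans (+-comm (fromℕ (e zero)) 1ℚ) (sym (fromℕ-+ 1 (e zero))) ⟩
        fromℕ (suc (e zero))                  ∎
        where open ≤-Reasoning

  wedge-lowerLBounded : LowerLBounded (wedge P bot)
  wedge-lowerLBounded = e zero , wedge-isE , λ β ε ½<β β<1 0<ε → eventually β ε ½<β β<1 0<ε
    where
    -- The numerator of a positive fraction is at least 1.
    inv-denominator≤ : ∀ ε → 0ℚ ℚ.< ε → inv (ℚ.↧ₙ ε) ℚ.≤ ε
    inv-denominator≤ (mkℚ (+ zero) b _)  (*<* (ℤ.+<+ ()))
    inv-denominator≤ (mkℚ -[1+ a ] b _) (*<* ())
    inv-denominator≤ (mkℚ (+ suc a) b c) _ = toℚᵘ-cancel-≤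
      (ℚᵘ.≤-respˡ-≃ (ℚᵘ.≃-sym (toℚᵘ-/ 1ℤ (suc b)))
        (ℚᵘ.*≤* (ℤ.*-monoʳ-≤-nonNeg (+ suc b) (ℤ.+≤+ {1} {suc a} (s≤s z≤n)))))

    -- For β = p/q the condition β < 1 means p + 1 ≤ q, so that n - βn ≥ n/q ≥ t.
    codepth : ∀ β t {a n} → ½ ℚ.< β → β ℚ.< 1ℚ → ℚ.↧ₙ β * t ≤ n →
              fromℕ a ℚ.< β ℚ.* fromℕ n → a + t ≤ n
    codepth (mkℚ -[1+ _ ] _ _) t (*<* ()) _ _ _
    codepth β@(mkℚ (+ p) q-1 _) t {a} {n} _ (*<* p<q) qt≤n a<βn = ℕ.<⇒≤ (ℕ.*-cancelˡ-< q (a + t) n (begin-strict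
      q * (a + t)    ≡⟨ ℕ.*-distribˡ-+ q a t ⟩
      q * a + q * t  <⟨ ℕ.+-mono-<-≤ qa<pn qt≤n ⟩
      p * n + n      ≡⟨ ℕ.+-comm (p * n) n ⟩
      suc p * n      ≤⟨ ℕ.*-monoˡ-≤ n (ℤ.drop‿+<+ (subst₂ ℤ._<_ (ℤ.*-identityʳ (+ p)) (ℤ.*-identityˡ (+ q)) p<q)) ⟩
      q * n          ∎))
      where
      open ℕ.≤-Reasoning
      q = suc q-1
      qa<pn : q * a < p * n
      qa<pn with ℚᵘ.*<* a*q<p*n ← ℚᵘ.<-respˡ-≃ (toℚᵘ-/ (+ a) 1) (ℚᵘ.<-respʳ-≃
        (ℚᵘ.≃-trans (toℚᵘ-homo-* β (fromℕ n)) (ℚᵘ.*-cong (ℚᵘ.≃-refl {toℚᵘ β}) (toℚᵘ-/ (+ n) 1)))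
        (toℚᵘ-mono-< a<βn))
        = ℤ.drop‿+<+ (subst₂ ℤ._<_
            (trans (sym (ℤ.pos-* a (q * 1))) (cong +_ (trans (cong (a *_) (ℕ.*-identityʳ q)) (ℕ.*-comm a q))))
            (trans (ℤ.*-identityʳ (+ p ℤ.* + n)) (sym (ℤ.pos-* p n)))
            a*q<p*n)

    eventually : ∀ (β ε : ℚ) → ½ ℚ.< β → β ℚ.< 1ℚ → 0ℚ ℚ.< ε →
      ∃ λ N → ∀ (n : ℕ) → N ≤ n → (F : Family n) (F? : Decidable₁ F) → Free (wedge P bot) F →
      (∀ A → F A → fromℕ ∣ A ∣ ℚ.< β ℚ.* fromℕ n) →
      lubell F? ℚ.≤ fromℕ (e zero) ℚ.+ ε
    eventually β ε ½<β β<1 0<ε = ℚ.↧ₙ β * t , λ n N≤n F F? free small → ≤-trans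
      (lubell-≤-of-wedge-free P bot e bound t (e+before≤ t) F? free
        (λ A FA → codepth β t ½<β β<1 N≤n (small A FA)))
      (+-monoʳ-≤ (fromℕ (e zero)) T/t≤ε)
      where
      b = ℚ.↧ₙ ε
      -- Chosen so that T/t ≤ (T+1)/t = 1/b ≤ ε.
      t = b * suc T
      T/t≤ε : fromℕ T ℚ.* inv t ℚ.≤ ε
      T/t≤ε = begin
        fromℕ T ℚ.* inv t        ≤⟨ *-monoʳ-≤-nonNeg (inv t) {{ℚ.nonNegative (0≤inv t)}} (fromℕ-mono-≤ (ℕ.n≤1+n T)) ⟩
        fromℕ (suc T) ℚ.* inv t  ≡⟨ cross-inv (suc T) 1 (trans (ℕ.*-comm (suc T) b) (sym (ℕ.*-identityˡ t))) ⟩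
        1ℚ ℚ.* inv b             ≡⟨ *-identityˡ (inv b) ⟩
        inv b                    ≤⟨ inv-denominator≤ ε 0<ε ⟩
        ε                        ∎
        where open ≤-Reasoning

  wedge-LBounded : (∀ i → e (suc i) < e zero) → LBounded (wedge P bot)
  wedge-LBounded e<e₀ = t , e zero , wedge-isE , λ n F F? free sizes →
    lubell-≤-of-wedge-free P bot e bound t e+before≤e₀ F? free (λ A FA → sizes A FA .proj₂)
    where
    t = suc T
    e+before≤e₀ : ∀ i → fromℕ (e i) ℚ.+ fromℕ (before (size ∘ P) i) ℚ.* inv t ℚ.≤ fromℕ (e zero)
    -- The first copy is chosen before any deletion and needs no slack; for the later ones the cost
    -- T/(T+1) fits into the gap of at least 1 below `e zero`.
    e+before≤e₀ zero    = ≤-reflexive (trans (cong (fromℕ (e zero) ℚ.+_) (*-zeroˡ (inv t))) (+-identityʳ _))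
    e+before≤e₀ (suc i) = begin
      fromℕ (e (suc i)) ℚ.+ fromℕ (before (size ∘ P) (suc i)) ℚ.* inv t
        ≤⟨ +-monoʳ-≤ (fromℕ (e (suc i)))
             (*-monoʳ-≤-nonNeg (inv t) {{ℚ.nonNegative (0≤inv t)}} (fromℕ-mono-≤ (before-≤ (size ∘ P) (suc i)))) ⟩
      fromℕ (e (suc i)) ℚ.+ fromℕ T ℚ.* inv t  ≤⟨ +-monoʳ-≤ (fromℕ (e (suc i))) (<⇒≤ (fromℕ-*-inv-suc<1 T)) ⟩
      fromℕ (e (suc i)) ℚ.+ 1ℚ                 ≡⟨ trans (+-comm (fromℕ (e (suc i))) 1ℚ) (sym (fromℕ-+ 1 (e (suc i)))) ⟩
      fromℕ (suc (e (suc i)))                  ≤⟨ fromℕ-mono-≤ (e<e₀ i) ⟩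
      fromℕ (e zero)                           ∎
      where open ≤-Reasoning

-- For m = 0 every set satisfies the size condition, and the value named inside `UniformlyLBounded`
-- is at most `e` by maximality.
lubellBound : ∀ {P e} → IsE P e → UniformlyLBounded P → LubellBound P e
lubellBound {e = e} (free , max) (e′ , (free′ , max′) , bound) {n} {F} F? P-free =
  ≤-trans (bound n F F? P-free (λ A _ → z≤n , ℕ.≤-trans (ℕ.≤-reflexive (ℕ.+-identityʳ ∣ A ∣)) (∣p∣≤n A)))
    (fromℕ-mono-≤ (max e′ free′))

theorem6p4 : (k : ℕ) (P : Fin (2 + k) → FinPoset) (bot : ∀ i → HasBottom (P i)) →
    (∀ i → UniformlyLBounded (P i)) →
    (e : Fin (2 + k) → ℕ) → (∀ i → IsE (P i) (e i)) →
    (∀ i j → i ≤ᶠ j → e j ≤ e i) →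
    LowerLBounded (wedge P bot) × (e (suc zero) < e zero → LBounded (wedge P bot))
theorem6p4 k P bot uniform e isE anti =
  wedge-lowerLBounded P bot e isE bound e≤e₀ ,
  λ e₁<e₀ → wedge-LBounded P bot e isE bound e≤e₀ (λ i → ℕ.≤-<-trans (anti (suc zero) (suc i) (s≤s z≤n)) e₁<e₀)
  where
  bound : ∀ i → LubellBound (P i) (e i)
  bound i = lubellBound (isE i) (uniform i)
  e≤e₀ : ∀ i → e i ≤ e zero
  e≤e₀ i = anti zero i z≤n
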